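{- Let $k\ge 9$ and $r\ge 3$ be integers, let $A$ be a $4k\times 4k$ binary matrix and let $P$ be an $r$-repetition-free $k$-permutation matrix. If $A$ has at most $(k/3)(k/r)^{1/3}$ $0$-entries, then $A$ contains $P$.
   Context: A $k$-permutation matrix is a $k\times k$ binary matrix with exactly one $1$-entry in every row and every column. A binary matrix $A$ contains a binary matrix $B$ if $B$ can be obtained from $A$ by deleting some rows, some columns, and changing some $1$-entries to $0$-entries. The distance vector from the $1$-entry at $(i_1,j_1)$ to the $1$-entry at $(i_2,j_2)$ is $(i_2-i_1,j_2-j_1)$. A vector is $r$-repeated in $P$ if it is the distance vector of at least $r$ pairs of $1$-entries of $P$; $P$ is $r$-repetition-free if no vector is $r$-repeated in $P$. -}

module Defs where

open import Data.Bool using (Bool; true; false; if_then_else_; not; _∧_)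
open import Data.Nat using (ℕ; zero; suc; _+_; _<_)
open import Data.Fin using (Fin; toℕ) renaming (zero to fzero; suc to fsuc; _<_ to _<ᶠ_)
import Data.Fin as F
open import Data.Integer as ℤ using (ℤ; +_; _-_)
open import Data.Product using (Σ; _×_; _,_; ∃)
open import Relation.Nullary.Decidable using (⌊_⌋)
open import Relation.Nullary using (¬_)
open import Relation.Binary.PropositionalEquality using (_≡_)

-- Binary m × n matrices: entry in row i, column j is  A i j  (true = 1, false = 0).
BinMatrix : ℕ → ℕ → Set
BinMatrix m n = Fin m → Fin n → Bool

sumFin : {n : ℕ} → (Fin n → ℕ) → ℕ
sumFin {zero}  f = 0
sumFin {suc n} f = f fzero + sumFin (λ i → f (fsuc i))

countFin : {n : ℕ} → (Fin n → Bool) → ℕ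
countFin f = sumFin (λ i → if f i then 1 else 0)

zeroEntries : {m n : ℕ} → BinMatrix m n → ℕ
zeroEntries A = sumFin (λ i → countFin (λ j → not (A i j)))

IsPermutationMatrix : {k : ℕ} → BinMatrix k k → Set
IsPermutationMatrix {k} P =
  ((i : Fin k) → countFin (λ j → P i j) ≡ 1) ×
  ((j : Fin k) → countFin (λ i → P i j) ≡ 1)

-- A (m × n) contains B (p × q): delete rows/columns (strictly increasing
-- embeddings of the kept rows/columns) and turn some 1s into 0s.
Contains : {m n p q : ℕ} → BinMatrix m n → BinMatrix p q → Set
Contains {m} {n} {p} {q} A B =
  Σ (Fin p → Fin m) λ f → Σ (Fin q → Fin n) λ g →
    ((i i' : Fin p) → i <ᶠ i' → f i <ᶠ f i') ×
    ((j j' : Fin q) → j <ᶠ j' → g j <ᶠ g j') ×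
    ((i : Fin p) (j : Fin q) → B i j ≡ true → A (f i) (g j) ≡ true)

distVec : {m n : ℕ} → Fin m → Fin n → Fin m → Fin n → ℤ × ℤ
distVec i₁ j₁ i₂ j₂ = ((+ toℕ i₂) - (+ toℕ i₁)) , ((+ toℕ j₂) - (+ toℕ j₁))

private
  sameEntry : {m n : ℕ} → Fin m → Fin n → Fin m → Fin n → Bool
  sameEntry i₁ j₁ i₂ j₂ = ⌊ i₁ F.≟ i₂ ⌋ ∧ ⌊ j₁ F.≟ j₂ ⌋

  eqVec : ℤ × ℤ → ℤ × ℤ → Bool
  eqVec (a , b) (c , d) = ⌊ a ℤ.≟ c ⌋ ∧ ⌊ b ℤ.≟ d ⌋

repetitions : {m n : ℕ} → BinMatrix m n → ℤ × ℤ → ℕ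
repetitions P v =
  sumFin λ i₁ → sumFin λ j₁ → sumFin λ i₂ → countFin λ j₂ →
    P i₁ j₁ ∧ P i₂ j₂ ∧ not (sameEntry i₁ j₁ i₂ j₂) ∧ eqVec (distVec i₁ j₁ i₂ j₂) v

RRepeated : {m n : ℕ} → ℕ → BinMatrix m n → ℤ × ℤ → Set
RRepeated r P v = r Data.Nat.≤ repetitions P v

RepetitionFree : {m n : ℕ} → ℕ → BinMatrix m n → Set
RepetitionFree r P = (v : ℤ × ℤ) → ¬ RRepeated r P v

{-# OPTIONS --safe #-}
module Submission where

{-
  Put d = ⌊z/k⌋, where z is the number of 0-entries of A.  Deleting k rows and k columns leaves a
  3k × 3k matrix with at most d zeros in each line, and the hypothesis gives 27 r d³ ≤ k.  Cut the rows
  of P into groups of w = 2d consecutive rows, reserve for each group 2w consecutive rows of A, and let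
  group number u slide within them: row i of P goes to row a + i + uw + s of A, where 0 ≤ s < w may
  depend on u, and column j goes to column b + j.  Groups slide independently, so there is no copy at
  offset (a , b) only if some group meets a zero, in its row e(s) say, for each of the w shifts s.

  Suppose this happens for all (k − w) · 2k offsets.  A fixed row of the group meets at most d zeros,
  all in one column, so e(s) ≠ e(s′) for at least w(w − d) of the pairs (s , s′).  On the other hand,
  for given s and s′ the two zeros met are less than 2w rows apart, which leaves at most 3k · d · 4w · d
  choices for them; they determine the distance vector of the entries of P in rows e(s) and e(s′),
  hence leave at most r − 1 offsets.  Counting both ways, k − 2d ≤ 24 (r − 1) d³, which contradicts
  27 r d³ ≤ k.
-}

open import Defs
open import Data.Nat using (ℕ; _≤_; _*_; _^_)
open import Data.Bool using (Bool; true; false; if_then_else_; not; _∧_)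
open import Data.Bool.Properties using (∧-conicalˡ; ∧-conicalʳ; ¬-not)
open import Data.Empty using (⊥; ⊥-elim)
open import Data.Nat using (zero; suc; _+_; _∸_; _<_; z≤n; s≤s; NonZero; >-nonZero)
open import Data.Nat.Properties
open import Data.Nat.DivMod using (_/_; _%_; _mod_; m/n*n≤m; m≡m%n+[m/n]*n; m%n<n; m<n⇒m%n≡m; m/n≤m; /-monoˡ-≤)
open import Data.Nat.Tactic.RingSolver using (solve-∀)
open import Data.Integer as ℤ using (ℤ; _-_)
import Data.Integer.Properties as ℤ
open import Data.Fin as Fin using (Fin; toℕ; fromℕ<) renaming (zero to fzero; suc to fsuc; _<_ to _<ᶠ_)
open import Data.Fin.Properties using (toℕ<n; toℕ-fromℕ<; toℕ-injective)
open import Data.List using (List; []; _∷_; _++_; map; length; tabulate; allFin; upTo; cartesianProduct)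
open import Data.List.Properties using (length-tabulate; length-upTo)
open import Data.List.Membership.Propositional using (_∈_)
open import Data.List.Membership.Propositional.Properties using (∈-allFin; ∈-upTo⁺; ∈-upTo⁻; ∈-cartesianProduct⁺)
open import Data.List.Relation.Unary.Any using (here; there)
open import Data.List.Relation.Unary.All as All using ([]; _∷_)
open import Data.List.Relation.Unary.AllPairs using ([]; _∷_)
open import Data.List.Relation.Unary.Unique.Propositional using (Unique)
open import Data.List.Relation.Unary.Unique.Propositional.Properties using (allFin⁺; upTo⁺; cartesianProduct⁺)
open import Data.Product using (Σ; ∃; ∃₂; _×_; _,_; proj₁; proj₂)
import Data.Product.Properties as Product
open import Data.Sum using (_⊎_; inj₁; inj₂; swap)
open import Relation.Binary using (DecidableEquality)
open import Relation.Binary.Definitions using (tri<; tri≈; tri>)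
open import Relation.Binary.PropositionalEquality
open import Relation.Nullary using (¬_; Dec; yes; no; contradiction)
open import Relation.Nullary.Decidable using (⌊_⌋)
open import Function using (_∘_; id; flip)

private variable
  X Y : Set

holds : (p? : Dec X) → ⌊ p? ⌋ ≡ true → X
holds (yes p) _ = p

holds⁺ : (p? : Dec X) → X → ⌊ p? ⌋ ≡ true
holds⁺ (yes _) _ = refl
holds⁺ (no ¬p) p = contradiction p ¬p

∧⁺ : ∀ {a b} → a ≡ true → b ≡ true → a ∧ b ≡ true
∧⁺ refl refl = refl

𝟙 : Bool → ℕ
𝟙 b = if b then 1 else 0

-- Finite sums

∑ : List X → (X → ℕ) → ℕ
∑ []       f = 0
∑ (x ∷ xs) f = f x + ∑ xs f

∑-mono : (xs : List X) {f g : X → ℕ} → (∀ x → f x ≤ g x) → ∑ xs f ≤ ∑ xs g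
∑-mono []       le = z≤n
∑-mono (x ∷ xs) le = +-mono-≤ (le x) (∑-mono xs le)

∑-zero : (xs : List X) → ∑ xs (λ _ → 0) ≡ 0
∑-zero []       = refl
∑-zero (x ∷ xs) = ∑-zero xs

∑-+ : (xs : List X) (f g : X → ℕ) → ∑ xs (λ x → f x + g x) ≡ ∑ xs f + ∑ xs g
∑-+ []       f g = refl
∑-+ (x ∷ xs) f g rewrite ∑-+ xs f g = interchange (f x) (g x) (∑ xs f) (∑ xs g)
  where
  interchange : ∀ a b c d → a + b + (c + d) ≡ a + c + (b + d)
  interchange = solve-∀

∑-swap : (xs : List X) (ys : List Y) (f : X → Y → ℕ) →
  ∑ xs (λ x → ∑ ys (f x)) ≡ ∑ ys (λ y → ∑ xs (λ x → f x y))
∑-swap []       ys f = sym (∑-zero ys)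
∑-swap (x ∷ xs) ys f = trans (cong (∑ ys (f x) +_) (∑-swap xs ys f))
  (sym (∑-+ ys (f x) (λ y → ∑ xs (λ x′ → f x′ y))))

∑-*ʳ : (xs : List X) (f : X → ℕ) (c : ℕ) → ∑ xs (λ x → f x * c) ≡ ∑ xs f * c
∑-*ʳ []       f c = refl
∑-*ʳ (x ∷ xs) f c = trans (cong (f x * c +_) (∑-*ʳ xs f c)) (sym (*-distribʳ-+ c (f x) (∑ xs f)))

∑-≤-length : (xs : List X) {f : X → ℕ} {c : ℕ} → (∀ x → f x ≤ c) → ∑ xs f ≤ length xs * c
∑-≤-length []       le = z≤n
∑-≤-length (x ∷ xs) le = +-mono-≤ (le x) (∑-≤-length xs le)

length-≤-∑ : (xs : List X) {f : X → ℕ} {c : ℕ} → (∀ x → c ≤ f x) → length xs * c ≤ ∑ xs f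
length-≤-∑ []       le = z≤n
length-≤-∑ (x ∷ xs) le = +-mono-≤ (le x) (length-≤-∑ xs le)

term-≤-∑ : {xs : List X} {x : X} (f : X → ℕ) → x ∈ xs → f x ≤ ∑ xs f
term-≤-∑ f (here refl) = m≤m+n _ _
term-≤-∑ f (there x∈xs) = ≤-trans (term-≤-∑ f x∈xs) (m≤n+m _ _)

∑-++ : (xs ys : List X) (f : X → ℕ) → ∑ (xs ++ ys) f ≡ ∑ xs f + ∑ ys f
∑-++ []       ys f = refl
∑-++ (x ∷ xs) ys f = trans (cong (f x +_) (∑-++ xs ys f)) (sym (+-assoc (f x) _ _))

∑-map : (g : X → Y) (xs : List X) (f : Y → ℕ) → ∑ (map g xs) f ≡ ∑ xs (f ∘ g)
∑-map g []       f = refl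
∑-map g (x ∷ xs) f = cong (f (g x) +_) (∑-map g xs f)

∑-cartesianProduct : (xs : List X) (ys : List Y) (f : X × Y → ℕ) →
  ∑ (cartesianProduct xs ys) f ≡ ∑ xs (λ x → ∑ ys (λ y → f (x , y)))
∑-cartesianProduct []       ys f = refl
∑-cartesianProduct (x ∷ xs) ys f = trans (∑-++ (map (x ,_) ys) (cartesianProduct xs ys) f)
  (cong₂ _+_ (∑-map (x ,_) ys f) (∑-cartesianProduct xs ys f))

length≡∑1 : (xs : List X) → length xs ≡ ∑ xs (λ _ → 1)
length≡∑1 []       = refl
length≡∑1 (x ∷ xs) = cong suc (length≡∑1 xs)

length-× : (xs : List X) (ys : List Y) → length (cartesianProduct xs ys) ≡ length xs * length ys
length-× xs ys = begin
  length (cartesianProduct xs ys)         ≡⟨ length≡∑1 (cartesianProduct xs ys) ⟩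
  ∑ (cartesianProduct xs ys) (λ _ → 1)    ≡⟨ ∑-cartesianProduct xs ys _ ⟩
  ∑ xs (λ _ → ∑ ys (λ _ → 1))             ≡⟨ ≤-antisym (∑-≤-length xs (λ _ → ≤-refl)) (length-≤-∑ xs (λ _ → ≤-refl)) ⟩
  length xs * ∑ ys (λ _ → 1)              ≡⟨ cong (length xs *_) (length≡∑1 ys) ⟨
  length xs * length ys                   ∎
  where open ≡-Reasoning

∑-tabulate : ∀ {n} (g : Fin n → X) (f : X → ℕ) → ∑ (tabulate g) f ≡ sumFin (f ∘ g)
∑-tabulate {n = zero}  g f = refl
∑-tabulate {n = suc n} g f = cong (f (g fzero) +_) (∑-tabulate (g ∘ fsuc) f)

∑-allFin : ∀ {n} (f : Fin n → ℕ) → ∑ (allFin n) f ≡ sumFin f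
∑-allFin f = ∑-tabulate id f

sumFin-mono : ∀ {n} {f g : Fin n → ℕ} → (∀ i → f i ≤ g i) → sumFin f ≤ sumFin g
sumFin-mono {zero}  le = z≤n
sumFin-mono {suc n} le = +-mono-≤ (le fzero) (sumFin-mono (le ∘ fsuc))

term-≤-sumFin : ∀ {n} (f : Fin n → ℕ) i → f i ≤ sumFin f
term-≤-sumFin f fzero    = m≤m+n _ _
term-≤-sumFin f (fsuc i) = ≤-trans (term-≤-sumFin (f ∘ fsuc) i) (m≤n+m _ _)

-- Counting elements of lists

𝟙-mono : ∀ {a b} → (a ≡ true → b ≡ true) → 𝟙 a ≤ 𝟙 b
𝟙-mono {false} imp = z≤n
𝟙-mono {true}  imp rewrite imp refl = ≤-refl

count-none : (xs : List X) (f : X → Bool) → (∀ {x} → x ∈ xs → f x ≡ true → ⊥) → ∑ xs (𝟙 ∘ f) ≡ 0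
count-none []       f none = refl
count-none (x ∷ xs) f none with f x in eq
... | true  = ⊥-elim (none (here refl) eq)
... | false = count-none xs f (none ∘ there)

-- An empty count is 0, so the bound matters only when some `x` is counted, and its proof may then
-- use what `f x` says.
count-≤-witnessed : (xs : List X) (f : X → Bool) {c : ℕ} →
  (∀ x → f x ≡ true → ∑ xs (𝟙 ∘ f) ≤ c) → ∑ xs (𝟙 ∘ f) ≤ c
count-≤-witnessed xs f le = by-total _ refl
  where
  witness : ∀ xs {n} → ∑ xs (𝟙 ∘ f) ≡ suc n → ∃ λ x → f x ≡ true
  witness (x ∷ xs) eq with f x in fx
  ... | true  = x , fx
  ... | false = witness xs eq
  by-total : ∀ n → ∑ xs (𝟙 ∘ f) ≡ n → ∑ xs (𝟙 ∘ f) ≤ _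
  by-total zero    eq = ≤-trans (≤-reflexive eq) z≤n
  by-total (suc n) eq = let x , fx = witness xs eq in le x fx

count-≤1 : {xs : List X} → Unique xs → (f : X → Bool) →
  (∀ {x y} → x ∈ xs → y ∈ xs → f x ≡ true → f y ≡ true → x ≡ y) → ∑ xs (𝟙 ∘ f) ≤ 1
count-≤1 [] f same = z≤n
count-≤1 {xs = x ∷ xs} (x∉xs ∷ uniq) f same with f x in eq
... | false = count-≤1 uniq f (λ p q → same (there p) (there q))
... | true  = ≤-reflexive (cong suc (count-none xs f
  (λ y∈xs fy → All.lookup x∉xs y∈xs (same (here refl) (there y∈xs) eq fy))))

-- Each counted `x` lies in the fibre of `φ` over some member of `ys`; exchange the two sums. The
-- bound `c` may vary with `y`, so that fibres known to be empty can cost 0.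
count-by-fibres : (_≟_ : DecidableEquality Y) (xs : List X) (ys : List Y)
  (f : X → Bool) (φ : X → Y) (c : Y → ℕ) →
  (∀ {x} → f x ≡ true → φ x ∈ ys) →
  (∀ y → ∑ xs (λ x → 𝟙 (f x ∧ ⌊ φ x ≟ y ⌋)) ≤ c y) →
  ∑ xs (𝟙 ∘ f) ≤ ∑ ys c
count-by-fibres _≟_ xs ys f φ c φ∈ fibre = begin
  ∑ xs (𝟙 ∘ f)                                         ≤⟨ ∑-mono xs in-own-fibre ⟩
  ∑ xs (λ x → ∑ ys (λ y → 𝟙 (f x ∧ ⌊ φ x ≟ y ⌋)))      ≡⟨ ∑-swap xs ys _ ⟩
  ∑ ys (λ y → ∑ xs (λ x → 𝟙 (f x ∧ ⌊ φ x ≟ y ⌋)))      ≤⟨ ∑-mono ys fibre ⟩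
  ∑ ys c                                               ∎
  where
  open ≤-Reasoning
  in-own-fibre : ∀ x → 𝟙 (f x) ≤ ∑ ys (λ y → 𝟙 (f x ∧ ⌊ φ x ≟ y ⌋))
  in-own-fibre x with f x in eq
  ... | false = z≤n
  ... | true  = ≤-trans (𝟙-mono {true} (λ _ → holds⁺ (φ x ≟ φ x) refl))
                        (term-≤-∑ (λ y → 𝟙 ⌊ φ x ≟ y ⌋) (φ∈ eq))

-- The fibres of `ψ` have at most one counted element, and none unless `h` holds. Injectivity is
-- asked only on members of `xs`, since reduction mod n is injective only on a range.
count-injection : (_≟_ : DecidableEquality Y) {xs : List X} {ys : List Y} → Unique xs →
  (f : X → Bool) (h : Y → Bool) (ψ : X → Y) →
  (∀ {x} → f x ≡ true → ψ x ∈ ys) →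
  (∀ {x} → f x ≡ true → h (ψ x) ≡ true) →
  (∀ {x x′} → x ∈ xs → x′ ∈ xs → f x ≡ true → f x′ ≡ true → ψ x ≡ ψ x′ → x ≡ x′) →
  ∑ xs (𝟙 ∘ f) ≤ ∑ ys (𝟙 ∘ h)
count-injection _≟_ {xs} {ys} uniq f h ψ ψ∈ f⇒h inj =
  count-by-fibres _≟_ xs ys f ψ (𝟙 ∘ h) ψ∈ λ y →
    count-≤-witnessed xs _ λ x p →
      let fx = ∧-conicalˡ (f x) _ p
          ψx≡y = holds (ψ x ≟ y) (∧-conicalʳ (f x) _ p)
      in ≤-trans
           (count-≤1 uniq _ λ {x₁} {x₂} x₁∈ x₂∈ p₁ p₂ →
             inj x₁∈ x₂∈ (∧-conicalˡ (f x₁) _ p₁) (∧-conicalˡ (f x₂) _ p₂)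
               (trans (holds (ψ x₁ ≟ y) (∧-conicalʳ (f x₁) _ p₁))
                      (sym (holds (ψ x₂ ≟ y) (∧-conicalʳ (f x₂) _ p₂)))))
           (𝟙-mono {true} (λ _ → subst (λ z → h z ≡ true) ψx≡y (f⇒h fx)))

count-complement : (xs : List X) (f : X → Bool) → ∑ xs (𝟙 ∘ f) + ∑ xs (𝟙 ∘ not ∘ f) ≡ length xs
count-complement []       f = refl
count-complement (x ∷ xs) f with f x
... | true  = cong suc (count-complement xs f)
... | false = trans (+-suc _ _) (cong suc (count-complement xs f))

-- A constructive form of excluded middle over a finite range; as `B` need not be the negation of
-- `A`, searches can be nested.
search : ∀ {n} {A B : Fin n → Set} → (∀ i → A i ⊎ B i) → ∃ A ⊎ (∀ i → B i)
search {zero}  test = inj₂ (λ ())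
search {suc n} test with test fzero | search (test ∘ fsuc)
... | inj₁ a | _             = inj₁ (fzero , a)
... | inj₂ b | inj₁ (i , a)  = inj₁ (fsuc i , a)
... | inj₂ b | inj₂ bs       = inj₂ λ { fzero → b ; (fsuc i) → bs i }

difference-≡ : ∀ m n p q → m + q ≡ n + p → (ℤ.+ m) - (ℤ.+ n) ≡ (ℤ.+ p) - (ℤ.+ q)
difference-≡ m n p q eq = begin
  (ℤ.+ m) - (ℤ.+ n)      ≡⟨ ℤ.m-n≡m⊖n m n ⟩
  m ℤ.⊖ n                ≡⟨ ℤ.+-cancelˡ-⊖ q m n ⟨
  (q + m) ℤ.⊖ (q + n)    ≡⟨ cong₂ ℤ._⊖_ (trans (+-comm q m) eq) (+-comm q n) ⟩
  (n + p) ℤ.⊖ (n + q)    ≡⟨ ℤ.+-cancelˡ-⊖ n p q ⟩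
  p ℤ.⊖ q                ≡⟨ ℤ.m-n≡m⊖n p q ⟨
  (ℤ.+ p) - (ℤ.+ q)      ∎
  where open ≡-Reasoning

-- Here `π i` is the column of the 1-entry in row `i`, so pairs of rows stand for pairs of
-- 1-entries; `c` will be r - 1.
FewRepetitions : ∀ {k} → (Fin k → Fin k) → ℕ → Set
FewRepetitions {k} π c = ∀ v → ∑ (cartesianProduct (allFin k) (allFin k))
  (λ (i , i′) → 𝟙 (not ⌊ i Fin.≟ i′ ⌋ ∧ ⌊ Product.≡-dec ℤ._≟_ ℤ._≟_ (distVec i (π i) i′ (π i′)) v ⌋)) ≤ c

-- The row index `x` is not confined to `x < N`, so that a computed index such as x + δ - 2w needs
-- no range check.
SparseRows : ℕ → ℕ → (ℕ → ℕ → Bool) → Set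
SparseRows N d Z = ∀ x → ∑ (upTo N) (λ y → 𝟙 (Z x y)) ≤ d

-- Groups of consecutive rows that slide independently

module ShiftedGroups
  (k α β N w d c : ℕ) ⦃ w≢0 : NonZero w ⦄
  (Z : ℕ → ℕ → Bool) (π : Fin k → Fin k)
  (α+w+2k≤N : α + w + (k + k) ≤ N) (β+k≤N : β + k ≤ N)
  (sparse-rows : SparseRows N d Z) (sparse-columns : SparseRows N d (flip Z))
  where

  -- Numbers in `Fin k` suffice because i / w ≤ i. Those past the last group name empty groups,
  -- which meet no zero.
  InGroup : Fin k → Fin k → Set
  InGroup u i = toℕ i / w ≡ toℕ u

  -- For `i` in group `u` the term `toℕ i` already contains uw, so the group lands in the 2w rows
  -- starting at a + 2uw.
  row : Fin α → Fin k → Fin w → Fin k → ℕ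
  row a u s i = toℕ a + toℕ u * w + (toℕ i + toℕ s)

  column : Fin β → Fin k → ℕ
  column b i = toℕ b + toℕ (π i)

  group-≤ : ∀ {u i} → InGroup u i → toℕ u * w ≤ toℕ i
  group-≤ {u} {i} i∈u = subst (λ q → q * w ≤ toℕ i) i∈u (m/n*n≤m (toℕ i) w)

  group-> : ∀ {u i} → InGroup u i → toℕ i < w + toℕ u * w
  group-> {u} {i} i∈u = begin-strict
    toℕ i                            ≡⟨ m≡m%n+[m/n]*n (toℕ i) w ⟩
    toℕ i % w + toℕ i / w * w        <⟨ +-monoˡ-< (toℕ i / w * w) (m%n<n (toℕ i) w) ⟩
    w + toℕ i / w * w                ≡⟨ cong (λ q → w + q * w) i∈u ⟩
    w + toℕ u * w                    ∎
    where open ≤-Reasoning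

  row-< : ∀ a u s i → InGroup u i → row a u s i < N
  row-< a u s i i∈u = begin-strict
    toℕ a + toℕ u * w + (toℕ i + toℕ s)  ≡⟨ regroup (toℕ a) (toℕ u * w) (toℕ i) (toℕ s) ⟩
    toℕ a + toℕ s + (toℕ u * w + toℕ i)  <⟨ +-mono-< (+-mono-< (toℕ<n a) (toℕ<n s)) (+-mono-< (≤-<-trans (group-≤ {u} {i} i∈u) (toℕ<n i)) (toℕ<n i)) ⟩
    α + w + (k + k)                      ≤⟨ α+w+2k≤N ⟩
    N                                    ∎
    where
    open ≤-Reasoning
    regroup : ∀ a q i s → a + q + (i + s) ≡ a + s + (q + i)
    regroup = solve-∀

  column-< : ∀ b i → column b i < N
  column-< b i = <-≤-trans (+-mono-< (toℕ<n b) (toℕ<n (π i))) β+k≤N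

  Good : Fin α → Fin β → Set
  Good a b = ∀ u → ∃ λ s → ∀ i → ¬ InGroup u i ⊎ Z (row a u s i) (column b i) ≡ false

  Bad : Fin α → Fin β → Set
  Bad a b = ∃ λ u → ∀ s → ∃ λ i → InGroup u i × Z (row a u s i) (column b i) ≡ true

  good-or-all-bad : ∃₂ Good ⊎ (∀ a b → Bad a b)
  good-or-all-bad =
    -- Each `swap` exchanges the two alternatives, which makes the quantifiers over `u`, `s` and `i`
    -- alternate.
    search λ a → search λ b → swap (search λ u → swap (search λ s → swap (search λ i → hit? a b u s i)))
    where
    hit? : ∀ a b u s i →
      InGroup u i × Z (row a u s i) (column b i) ≡ true ⊎
      (¬ InGroup u i ⊎ Z (row a u s i) (column b i) ≡ false)
    hit? a b u s i with toℕ i / w ≟ toℕ u | Z (row a u s i) (column b i) in eq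
    ... | no i∉u  | _     = inj₂ (inj₁ i∉u)
    ... | yes i∈u | true  = inj₁ (i∈u , refl)
    ... | yes i∈u | false = inj₂ (inj₂ refl)

  module Copy (a : Fin α) (b : Fin β) (good : Good a b) where

    group : Fin k → Fin k
    group i = fromℕ< (≤-<-trans (m/n≤m (toℕ i) w) (toℕ<n i))

    ∈group : ∀ i → InGroup (group i) i
    ∈group i = sym (toℕ-fromℕ< _)

    shift : Fin k → Fin w
    shift u = proj₁ (good u)

    place : Fin k → ℕ
    place i = row a (group i) (shift (group i)) i

    place-< : ∀ i → place i < N
    place-< i = row-< a (group i) _ i (∈group i)

    place-free : ∀ i → Z (place i) (column b i) ≡ false
    place-free i with proj₂ (good (group i)) i
    ... | inj₁ i∉ = contradiction (∈group i) i∉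
    ... | inj₂ z≡ = z≡

    -- Rows of one group share their shift. Between different groups the term uw grows by at least
    -- w, which exceeds any shift of the lower row.
    place-mono : ∀ i i′ → i <ᶠ i′ → place i < place i′
    place-mono i i′ i<i′ with m≤n⇒m<n∨m≡n (subst₂ _≤_ (∈group i) (∈group i′) (/-monoˡ-≤ w (<⇒≤ i<i′)))
    ... | inj₂ same rewrite toℕ-injective {i = group i} {j = group i′} same =
      +-monoʳ-< (toℕ a + toℕ (group i′) * w) (+-monoˡ-< _ i<i′)
    ... | inj₁ u<u′ = begin-strict
      toℕ a + toℕ u * w + (toℕ i + toℕ (shift u))  <⟨ +-monoʳ-< (toℕ a + toℕ u * w) (+-mono-< i<i′ (toℕ<n (shift u))) ⟩
      toℕ a + toℕ u * w + (toℕ i′ + w)             ≡⟨ regroup (toℕ a) (toℕ u * w) (toℕ i′) w ⟩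
      toℕ a + (suc (toℕ u) * w) + toℕ i′           ≤⟨ +-mono-≤ (+-monoʳ-≤ (toℕ a) (*-monoˡ-≤ w u<u′)) (m≤m+n (toℕ i′) _) ⟩
      place i′                                     ∎
      where
      open ≤-Reasoning
      u = group i
      regroup : ∀ a q i w → a + q + (i + w) ≡ a + (w + q) + i
      regroup = solve-∀

  -- Double counting when every offset is blocked

  module Overcount
    (few-repetitions : FewRepetitions π c)
    (bad : ∀ a b → Bad a b)
    where

    u : Fin α → Fin β → Fin k
    u a b = proj₁ (bad a b)

    e : Fin α → Fin β → Fin w → Fin k
    e a b s = proj₁ (proj₂ (bad a b) s)

    e∈u : ∀ a b s → InGroup (u a b) (e a b s)
    e∈u a b s = proj₁ (proj₂ (proj₂ (bad a b) s))

    x : Fin α → Fin β → Fin w → ℕ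
    x a b s = row a (u a b) s (e a b s)

    y : Fin α → Fin β → Fin w → ℕ
    y a b s = column b (e a b s)

    hit : ∀ a b s → Z (x a b s) (y a b s) ≡ true
    hit a b s = proj₂ (proj₂ (proj₂ (bad a b) s))

    differ : Fin w → Fin w → Fin α × Fin β → Bool
    differ s s′ (a , b) = not ⌊ e a b s Fin.≟ e a b s′ ⌋

    -- The shifts that share the row `e a b s` give zeros in distinct rows of the single column
    -- `y a b s`.
    many-differ : ∀ a b s → w ∸ d ≤ ∑ (allFin w) (λ s′ → 𝟙 (differ s s′ (a , b)))
    many-differ a b s = m≤n+o⇒m∸n≤o w d (begin
      w                                   ≡⟨ length-tabulate {n = w} id ⟨
      length (allFin w)                   ≡⟨ count-complement (allFin w) same ⟨
      ∑ (allFin w) (𝟙 ∘ same) + _         ≤⟨ +-monoˡ-≤ _ few-same ⟩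
      d + _                               ∎)
      where
      open ≤-Reasoning
      same : Fin w → Bool
      same s′ = ⌊ e a b s Fin.≟ e a b s′ ⌋
      few-same : ∑ (allFin w) (𝟙 ∘ same) ≤ d
      few-same = ≤-trans
        (count-injection _≟_ {ys = upTo N} (allFin⁺ w) same (λ x′ → Z x′ (y a b s)) (x a b)
          (λ {s′} _ → ∈-upTo⁺ (row-< a (u a b) s′ (e a b s′) (e∈u a b s′)))
          (λ {s′} p → subst (λ i → Z (x a b s′) (column b i) ≡ true) (sym (holds (e a b s Fin.≟ e a b s′) p)) (hit a b s′))
          (λ {s₁} {s₂} _ _ p₁ p₂ x₁≡x₂ → toℕ-injective
            (+-cancelˡ-≡ (toℕ (e a b s)) _ _ (+-cancelˡ-≡ (toℕ a + toℕ (u a b) * w) _ _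
              (subst₂ (λ i j → row a (u a b) s₁ i ≡ row a (u a b) s₂ j)
                (sym (holds (e a b s Fin.≟ e a b s₁) p₁)) (sym (holds (e a b s Fin.≟ e a b s₂) p₂)) x₁≡x₂)))))
        (sparse-columns (y a b s))

    -- The row displacement from the zero for `s` to the zero for `s′`, raised by 2w. Both rows lie
    -- in one group and both shifts are below w, so the result is a natural number less than 4w.
    δ : Fin w → Fin w → Fin α → Fin β → ℕ
    δ s s′ a b = (toℕ (e a b s′) + toℕ s′ + (w + w)) ∸ (toℕ (e a b s) + toℕ s)

    δ-spec : ∀ s s′ a b → (toℕ (e a b s) + toℕ s) + δ s s′ a b ≡ toℕ (e a b s′) + toℕ s′ + (w + w)
    δ-spec s s′ a b = m+[n∸m]≡n (begin
      toℕ i + toℕ s                        ≤⟨ +-mono-≤ (<⇒≤ (group-> (e∈u a b s))) (<⇒≤ (toℕ<n s)) ⟩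
      w + toℕ (u a b) * w + w              ≤⟨ +-monoˡ-≤ w (+-monoʳ-≤ w (group-≤ (e∈u a b s′))) ⟩
      w + toℕ i′ + w                       ≡⟨ regroup w (toℕ i′) ⟩
      toℕ i′ + (w + w)                     ≤⟨ +-monoˡ-≤ (w + w) (m≤m+n (toℕ i′) (toℕ s′)) ⟩
      toℕ i′ + toℕ s′ + (w + w)            ∎)
      where
      open ≤-Reasoning
      i = e a b s
      i′ = e a b s′
      regroup : ∀ w i → w + i + w ≡ i + (w + w)
      regroup = solve-∀

    δ-< : ∀ s s′ a b → δ s s′ a b < 4 * w
    δ-< s s′ a b = +-cancelˡ-< (toℕ i + toℕ s) _ _ (begin-strict
      toℕ i + toℕ s + δ s s′ a b               ≡⟨ δ-spec s s′ a b ⟩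
      toℕ i′ + toℕ s′ + (w + w)                <⟨ +-monoˡ-< (w + w) (+-mono-< (group-> (e∈u a b s′)) (toℕ<n s′)) ⟩
      w + toℕ (u a b) * w + w + (w + w)        ≡⟨ regroup w (toℕ (u a b) * w) ⟩
      toℕ (u a b) * w + 4 * w                  ≤⟨ +-monoˡ-≤ (4 * w) (≤-trans (group-≤ (e∈u a b s)) (m≤m+n (toℕ i) (toℕ s))) ⟩
      toℕ i + toℕ s + 4 * w                    ∎)
      where
      open ≤-Reasoning
      i = e a b s
      i′ = e a b s′
      regroup : ∀ w q → w + q + w + (w + w) ≡ q + 4 * w
      regroup = solve-∀

    x-δ : ∀ s s′ a b → x a b s + δ s s′ a b ∸ (w + w) ≡ x a b s′
    x-δ s s′ a b = begin
      base + (toℕ (e a b s) + toℕ s) + δ s s′ a b ∸ (w + w)        ≡⟨ cong (_∸ (w + w)) (+-assoc base _ _) ⟩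
      base + (toℕ (e a b s) + toℕ s + δ s s′ a b) ∸ (w + w)        ≡⟨ cong (λ n → base + n ∸ (w + w)) (δ-spec s s′ a b) ⟩
      base + (toℕ (e a b s′) + toℕ s′ + (w + w)) ∸ (w + w)         ≡⟨ cong (_∸ (w + w)) (+-assoc base _ _) ⟨
      base + (toℕ (e a b s′) + toℕ s′) + (w + w) ∸ (w + w)         ≡⟨ m+n∸n≡m _ (w + w) ⟩
      x a b s′                                                     ∎
      where
      open ≡-Reasoning
      base = toℕ a + toℕ (u a b) * w

    -- ((x , δ) , (y , y′)) stands for the pair of zeros (x , y) and (x + δ − 2w , y′).
    Key : Set
    Key = (ℕ × ℕ) × (ℕ × ℕ)

    _≟ᴷ_ : DecidableEquality Key
    _≟ᴷ_ = Product.≡-dec (Product.≡-dec _≟_ _≟_) (Product.≡-dec _≟_ _≟_)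

    key : Fin w → Fin w → Fin α × Fin β → Key
    key s s′ (a , b) = (x a b s , δ s s′ a b) , (y a b s , y a b s′)

    keys : List Key
    keys = cartesianProduct (cartesianProduct (upTo N) (upTo (4 * w))) (cartesianProduct (upTo N) (upTo N))

    key∈keys : ∀ s s′ ab → key s s′ ab ∈ keys
    key∈keys s s′ (a , b) = ∈-cartesianProduct⁺
      (∈-cartesianProduct⁺ (∈-upTo⁺ (row-< a (u a b) s (e a b s) (e∈u a b s))) (∈-upTo⁺ (δ-< s s′ a b)))
      (∈-cartesianProduct⁺ (∈-upTo⁺ (column-< b (e a b s))) (∈-upTo⁺ (column-< b (e a b s′))))

    shifts : List (Fin α × Fin β)
    shifts = cartesianProduct (allFin α) (allFin β)

    shifts-unique : Unique shifts
    shifts-unique = cartesianProduct⁺ (allFin⁺ α) (allFin⁺ β)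

    -- By `δ-spec`, e(s′) - e(s) = (s + δ) - (s′ + 2w), while `b` cancels from y′ - y. With the two
    -- shifts fixed, the distance vector is thus a function of the key.
    vec : Fin w → Fin w → Key → ℤ × ℤ
    vec s s′ ((_ , δ) , (y , y′)) = ((ℤ.+ (toℕ s + δ)) - (ℤ.+ (toℕ s′ + (w + w)))) , ((ℤ.+ y′) - (ℤ.+ y))

    vec-key : ∀ s s′ a b → distVec (e a b s) (π (e a b s)) (e a b s′) (π (e a b s′)) ≡ vec s s′ (key s s′ (a , b))
    vec-key s s′ a b = cong₂ _,_
      (difference-≡ (toℕ (e a b s′)) (toℕ (e a b s)) _ _ (trans (sym (+-assoc (toℕ (e a b s′)) _ _)) (trans (sym (δ-spec s s′ a b)) (+-assoc (toℕ (e a b s)) _ _))))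
      (difference-≡ (toℕ (π (e a b s′))) (toℕ (π (e a b s))) _ _ (regroup (toℕ (π (e a b s′))) (toℕ b) (toℕ (π (e a b s)))))
      where
      regroup : ∀ p b q → p + (b + q) ≡ q + (b + p)
      regroup = solve-∀

    -- A key together with the pair of rows of P determines the shift, and by vec-key
    -- all these pairs of entries have the same distance vector.
    fibre-≤ : ∀ s s′ κ → ∑ shifts (λ ab → 𝟙 (differ s s′ ab ∧ ⌊ key s s′ ab ≟ᴷ κ ⌋)) ≤ c
    fibre-≤ s s′ κ = ≤-trans
      (count-injection (Product.≡-dec Fin._≟_ Fin._≟_) {ys = cartesianProduct (allFin k) (allFin k)} shifts-unique
        _ _ rows
        (λ _ → ∈-cartesianProduct⁺ (∈-allFin _) (∈-allFin _))
        (λ {ab} p → ∧⁺ (∧-conicalˡ (differ s s′ ab) _ p)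
          (holds⁺ (Product.≡-dec ℤ._≟_ ℤ._≟_ _ _) (trans (vec-key s s′ _ _) (cong (vec s s′) (key≡ ab p)))))
        (λ {ab} {ab′} _ _ p p′ → determined ab ab′ (trans (key≡ ab p) (sym (key≡ ab′ p′)))))
      (few-repetitions (vec s s′ κ))
      where
      rows : Fin α × Fin β → Fin k × Fin k
      rows (a , b) = e a b s , e a b s′
      key≡ : ∀ ab → differ s s′ ab ∧ ⌊ key s s′ ab ≟ᴷ κ ⌋ ≡ true → key s s′ ab ≡ κ
      key≡ ab p = holds (key s s′ ab ≟ᴷ κ) (∧-conicalʳ (differ s s′ ab) _ p)
      -- The row e(s) of P determines its group number; then the coordinate x yields `a`, and y
      -- yields `b`.
      determined : ∀ ab ab′ → key s s′ ab ≡ key s s′ ab′ → rows ab ≡ rows ab′ → ab ≡ ab′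
      determined (a , b) (a′ , b′) key≡key rows≡rows = cong₂ _,_
        (toℕ-injective (+-cancelʳ-≡ (toℕ (u a b) * w) _ _ (+-cancelʳ-≡ (toℕ (e a b s) + toℕ s) _ _
          (trans (cong (proj₁ ∘ proj₁) key≡key)
            (cong₂ (λ q i → toℕ a′ + q * w + (toℕ i + toℕ s)) (sym u≡u) (sym e≡e))))))
        (toℕ-injective (+-cancelʳ-≡ (toℕ (π (e a b s))) _ _
          (trans (cong (proj₁ ∘ proj₂) key≡key) (cong (λ i → toℕ b′ + toℕ (π i)) (sym e≡e)))))
        where
        e≡e : e a b s ≡ e a′ b′ s
        e≡e = cong proj₁ rows≡rows
        u≡u : toℕ (u a b) ≡ toℕ (u a′ b′)
        u≡u = trans (sym (e∈u a b s)) (trans (cong (λ i → toℕ i / w) e≡e) (e∈u a′ b′ s))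

    -- The capacity of a key: `c` if both its positions are zeros, otherwise 0. The product form
    -- lets the sum over y and y′ split into two row counts.
    zeros : Key → ℕ
    zeros ((x , δ) , (y , y′)) = 𝟙 (Z x y) * (𝟙 (Z (x + δ ∸ (w + w)) y′) * c)

    -- An offset in the fibre shows, through `hit`, that both positions of the key are zeros, so its
    -- capacity is `c`.
    fibre-≤-zeros : ∀ s s′ κ → ∑ shifts (λ ab → 𝟙 (differ s s′ ab ∧ ⌊ key s s′ ab ≟ᴷ κ ⌋)) ≤ zeros κ
    fibre-≤-zeros s s′ κ = count-≤-witnessed shifts _ λ (a , b) p →
      ≤-trans (fibre-≤ s s′ κ)
        (subst (λ κ → c ≤ zeros κ) (holds (key s s′ (a , b) ≟ᴷ κ) (∧-conicalʳ (differ s s′ (a , b)) _ p))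
          (≤-reflexive (sym (zeros-key a b))))
      where
      zeros-key : ∀ a b → zeros (key s s′ (a , b)) ≡ c
      zeros-key a b rewrite x-δ s s′ a b | hit a b s | hit a b s′ = trans (+-identityʳ _) (+-identityʳ c)

    -- Once x and δ are chosen, both rows are fixed, and each holds at most `d` zeros.
    zeros-total : ∑ keys zeros ≤ N * (4 * w) * (d * (d * c))
    zeros-total = begin
      ∑ keys zeros
        ≡⟨ ∑-cartesianProduct (cartesianProduct (upTo N) (upTo (4 * w))) _ zeros ⟩
      ∑ (cartesianProduct (upTo N) (upTo (4 * w))) (λ κ → ∑ (cartesianProduct (upTo N) (upTo N)) (λ κ′ → zeros (κ , κ′)))
        ≤⟨ ∑-≤-length (cartesianProduct (upTo N) (upTo (4 * w))) inner ⟩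
      length (cartesianProduct (upTo N) (upTo (4 * w))) * (d * (d * c))
        ≡⟨ cong (_* (d * (d * c))) (trans (length-× (upTo N) (upTo (4 * w))) (cong₂ _*_ (length-upTo N) (length-upTo (4 * w)))) ⟩
      N * (4 * w) * (d * (d * c))
        ∎
      where
      open ≤-Reasoning
      inner : ∀ κ → ∑ (cartesianProduct (upTo N) (upTo N)) (λ κ′ → zeros (κ , κ′)) ≤ d * (d * c)
      inner (x , δ) = begin
        ∑ (cartesianProduct (upTo N) (upTo N)) (λ κ′ → zeros ((x , δ) , κ′))
          ≡⟨ ∑-cartesianProduct (upTo N) (upTo N) _ ⟩
        ∑ (upTo N) (λ y → ∑ (upTo N) (λ y′ → 𝟙 (Z x y) * (𝟙 (Z x′ y′) * c)))
          ≤⟨ ∑-mono (upTo N) row-bound ⟩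
        ∑ (upTo N) (λ y → 𝟙 (Z x y) * (d * c))
          ≡⟨ ∑-*ʳ (upTo N) _ (d * c) ⟩
        ∑ (upTo N) (λ y → 𝟙 (Z x y)) * (d * c)
          ≤⟨ *-monoˡ-≤ (d * c) (sparse-rows x) ⟩
        d * (d * c)
          ∎
        where
        x′ = x + δ ∸ (w + w)
        row-bound : ∀ y → ∑ (upTo N) (λ y′ → 𝟙 (Z x y) * (𝟙 (Z x′ y′) * c)) ≤ 𝟙 (Z x y) * (d * c)
        row-bound y with Z x y
        ... | false = ≤-reflexive (∑-zero (upTo N))
        ... | true  = begin
          ∑ (upTo N) (λ y′ → 𝟙 (Z x′ y′) * c + 0)   ≤⟨ ∑-mono (upTo N) (λ y′ → ≤-reflexive (+-identityʳ _)) ⟩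
          ∑ (upTo N) (λ y′ → 𝟙 (Z x′ y′) * c)       ≡⟨ ∑-*ʳ (upTo N) _ c ⟩
          ∑ (upTo N) (λ y′ → 𝟙 (Z x′ y′)) * c       ≤⟨ *-monoˡ-≤ c (sparse-rows x′) ⟩
          d * c                                     ≡⟨ +-identityʳ _ ⟨
          d * c + 0                                 ∎

    few-differ : ∀ s s′ → ∑ shifts (λ ab → 𝟙 (differ s s′ ab)) ≤ N * (4 * w) * (d * (d * c))
    few-differ s s′ = ≤-trans
      (count-by-fibres _≟ᴷ_ shifts keys (differ s s′) (key s s′) zeros (λ {ab} _ → key∈keys s s′ ab) (fibre-≤-zeros s s′))
      zeros-total

    -- Both sides estimate the number of (a, b, s, s′) with e(s) ≠ e(s′): from below offset by
    -- offset, from above for each pair of shifts.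
    double-count : α * β * (w * (w ∸ d)) ≤ w * (w * (N * (4 * w) * (d * (d * c))))
    double-count = begin
      α * β * (w * (w ∸ d))
        ≡⟨ cong₂ _*_ (sym (trans (length-× (allFin α) (allFin β)) (cong₂ _*_ (length-tabulate {n = α} id) (length-tabulate {n = β} id)))) (cong (_* (w ∸ d)) (sym length-w)) ⟩
      length shifts * (length (allFin w) * (w ∸ d))
        ≤⟨ length-≤-∑ shifts (λ (a , b) → length-≤-∑ (allFin w) (many-differ a b)) ⟩
      ∑ shifts (λ ab → ∑ (allFin w) (λ s → ∑ (allFin w) (λ s′ → 𝟙 (differ s s′ ab))))
        ≡⟨ ∑-swap shifts (allFin w) _ ⟩
      ∑ (allFin w) (λ s → ∑ shifts (λ ab → ∑ (allFin w) (λ s′ → 𝟙 (differ s s′ ab))))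
        ≤⟨ ∑-≤-length (allFin w) (λ s → ≤-trans (≤-reflexive (∑-swap shifts (allFin w) _)) (∑-≤-length (allFin w) (few-differ s))) ⟩
      length (allFin w) * (length (allFin w) * (N * (4 * w) * (d * (d * c))))
        ≡⟨ cong (λ n → n * (n * (N * (4 * w) * (d * (d * c))))) length-w ⟩
      w * (w * (N * (4 * w) * (d * (d * c))))
        ∎
      where
      open ≤-Reasoning
      length-w : length (allFin w) ≡ w
      length-w = length-tabulate {n = w} id

-- Choice of parameters and the final inequality

ZeroFreeCopy : ∀ {k} → ℕ → (ℕ → ℕ → Bool) → (Fin k → Fin k) → Set
ZeroFreeCopy {k} N Z π = Σ (Fin k → ℕ) λ p → Σ ℕ λ b →
  (∀ i → p i < N) × (∀ i i′ → i <ᶠ i′ → p i < p i′) × b + k ≤ N ×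
  (∀ i → Z (p i) (b + toℕ (π i)) ≡ false)

zero-free-copy : ∀ {k} d c (Z : ℕ → ℕ → Bool) (π : Fin k → Fin k) →
  27 * suc c * (d * d * d) ≤ k → FewRepetitions π c →
  SparseRows (3 * k) d Z → SparseRows (3 * k) d (flip Z) → ZeroFreeCopy (3 * k) Z π
-- For d = 0 the group size 2d would vanish; but then there are no zeros in range, and the top left
-- corner serves.
zero-free-copy {k} zero c Z π _ _ rows _ =
  toℕ , 0 , (λ i → <-≤-trans (toℕ<n i) k≤3k) , (λ _ _ → id) , k≤3k ,
  λ i → ¬-not λ z → n≮0 (≤-trans
    (≤-trans (≤-reflexive (cong 𝟙 (sym z))) (term-≤-∑ (λ y → 𝟙 (Z (toℕ i) y)) (∈-upTo⁺ (<-≤-trans (toℕ<n (π i)) k≤3k))))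
    (rows (toℕ i)))
  where
  k≤3k : k ≤ 3 * k
  k≤3k = m≤n*m k 3
zero-free-copy {k} d@(suc _) c Z π 27cd³≤k few rows columns = conclude good-or-all-bad
  where
  -- With w = 2d at least half of the pairs of shifts have different rows. The choice α = k - w
  -- makes α + w + 2k equal to 3k.
  w = d + d
  α = k ∸ w
  d≤d³ : d ≤ d * d * d
  d≤d³ = ≤-trans (m≤m*n d (d * d)) (≤-reflexive (sym (*-assoc d d d)))
  -- Of the 27d³ that `suc c` adds to 27cd³, two copies of d³ pay for 2d, and the other 25 make the
  -- inequality strict.
  2d+24cd³<k : d + d + 24 * c * (d * d * d) < k
  2d+24cd³<k = begin-strict
    d + d + 24 * c * (d * d * d)                      ≤⟨ +-mono-≤ (+-mono-≤ d≤d³ d≤d³) (*-monoˡ-≤ (d * d * d) (*-monoˡ-≤ c (m≤m+n 24 3))) ⟩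
    d * d * d + d * d * d + 27 * c * (d * d * d)      <⟨ +-monoˡ-< (27 * c * (d * d * d)) (≤-trans (≤-reflexive (+-comm 1 _)) (+-mono-≤ (≤-refl {d * d * d + d * d * d}) (≤-trans (s≤s z≤n) (m≤n*m (d * d * d) 25)))) ⟩
    d * d * d + d * d * d + 25 * (d * d * d) + 27 * c * (d * d * d)   ≡⟨ collect c (d * d * d) ⟩
    27 * suc c * (d * d * d)                          ≤⟨ 27cd³≤k ⟩
    k                                                 ∎
    where
    open ≤-Reasoning
    collect : ∀ c D → D + D + 25 * D + 27 * c * D ≡ 27 * (1 + c) * D
    collect = solve-∀
  w≤k : w ≤ k
  w≤k = ≤-trans (m≤m+n w _) (<⇒≤ 2d+24cd³<k)
  open ShiftedGroups k α (2 * k) (3 * k) w d c Z π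
    (≤-reflexive (trans (cong (_+ (k + k)) (m∸n+n≡m w≤k)) (cong (λ n → k + (k + n)) (sym (+-identityʳ k)))))
    (≤-reflexive (+-comm (2 * k) k))
    rows columns
  conclude : ∃₂ Good ⊎ (∀ a b → Bad a b) → ZeroFreeCopy (3 * k) Z π
  conclude (inj₁ (a , b , good)) =
    place , toℕ b , place-< , place-mono ,
    ≤-trans (+-monoˡ-≤ k (<⇒≤ (toℕ<n b))) (≤-reflexive (+-comm (2 * k) k)) , place-free
    where open Copy a b good
  conclude (inj₂ bad) = contradiction α≤24cd³ (<⇒≱ 24cd³<α)
    where
    open Overcount few bad
    instance
      k≢0 : NonZero k
      k≢0 = >-nonZero (≤-<-trans z≤n 2d+24cd³<k)
      factor≢0 : NonZero (4 * k * d * d)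
      factor≢0 = m*n≢0 (4 * k * d) d ⦃ m*n≢0 (4 * k) d ⦃ m*n≢0 4 k ⦄ ⦄
    α≤24cd³ : α ≤ 24 * c * (d * d * d)
    -- With w = 2d, both sides of `double-count` are multiples of 4kd².
    α≤24cd³ = *-cancelˡ-≤ (4 * k * d * d) (begin
      4 * k * d * d * α                                   ≡⟨ left k d α ⟩
      α * (2 * k) * (w * d)                               ≡⟨ cong (λ n → α * (2 * k) * (w * n)) (m+n∸n≡m d d) ⟨
      α * (2 * k) * (w * (w ∸ d))                         ≤⟨ double-count ⟩
      w * (w * (3 * k * (4 * w) * (d * (d * c))))         ≡⟨ right k d c ⟩
      4 * k * d * d * (24 * c * (d * d * d))              ∎)
      where
      open ≤-Reasoning
      left : ∀ k d α → 4 * k * d * d * α ≡ α * (2 * k) * ((d + d) * d)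
      left = solve-∀
      right : ∀ k d c → (d + d) * ((d + d) * (3 * k * (4 * (d + d)) * (d * (d * c)))) ≡ 4 * k * d * d * (24 * c * (d * d * d))
      right = solve-∀
    24cd³<α : 24 * c * (d * d * d) < α
    24cd³<α = +-cancelˡ-< w _ _ (<-≤-trans 2d+24cd³<k (m≤n+m∸n k w))

-- Deleting dense rows and columns

Increasing : ∀ {m n} → (Fin m → Fin n) → Set
Increasing f = ∀ i i′ → i <ᶠ i′ → f i <ᶠ f i′

increasing-injective : ∀ {m n} {f : Fin m → Fin n} → Increasing f → ∀ {i i′} → f i ≡ f i′ → i ≡ i′
increasing-injective {f = f} inc {i} {i′} eq with <-cmp (toℕ i) (toℕ i′)
... | tri< i<i′ _ _ = contradiction (inc i i′ i<i′) (<-irrefl (cong toℕ eq))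
... | tri≈ _ i≡i′ _ = toℕ-injective i≡i′
... | tri> _ _ i′<i = contradiction (inc i′ i i′<i) (<-irrefl (cong toℕ (sym eq)))

-- Scan from the front: a marked index is skipped at the expense of the spare room n - m, an
-- unmarked one is kept.
select-unmarked : ∀ m n (marked : Fin n → Bool) → m + countFin marked ≤ n →
  Σ (Fin m → Fin n) λ ρ → Increasing ρ × (∀ i → marked (ρ i) ≡ false)
select-unmarked zero    n       marked le = (λ ()) , (λ ()) , λ ()
select-unmarked (suc m) (suc n) marked le with marked fzero in eq
... | true =
  let ρ , inc , free = select-unmarked (suc m) n (marked ∘ fsuc) (≤-trans (≤-reflexive (sym (+-suc m _))) (≤-pred le))
  in fsuc ∘ ρ , (λ i i′ i<i′ → s≤s (inc i i′ i<i′)) , free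
... | false = cons ρ , cons-increasing , cons-free
  where
  selection = select-unmarked m n (marked ∘ fsuc) (≤-pred le)
  ρ = proj₁ selection
  cons : (Fin m → Fin n) → Fin (suc m) → Fin (suc n)
  cons ρ fzero    = fzero
  cons ρ (fsuc i) = fsuc (ρ i)
  cons-increasing : Increasing (cons ρ)
  cons-increasing fzero    (fsuc i′) _          = s≤s z≤n
  cons-increasing (fsuc i) (fsuc i′) (s≤s i<i′) = s≤s (proj₁ (proj₂ selection) i i′ i<i′)
  cons-free : ∀ i → marked (cons ρ i) ≡ false
  cons-free fzero    = eq
  cons-free (fsuc i) = proj₂ (proj₂ selection) i

markov : ∀ {n} d (f : Fin n → ℕ) → countFin (λ i → ⌊ d <? f i ⌋) * suc d ≤ sumFin f
markov {zero}  d f = z≤n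
markov {suc n} d f with d <? f fzero
... | yes d<f = +-mono-≤ d<f (markov d (f ∘ fsuc))
... | no  _   = ≤-trans (markov d (f ∘ fsuc)) (m≤n+m _ (f fzero))

-- If k lines had more than ⌊z/k⌋ zeros each, there would be at least k(⌊z/k⌋ + 1) > z zeros in all.
select-sparse : ∀ {k} m z ⦃ _ : NonZero k ⦄ (f : Fin (m + k) → ℕ) → sumFin f ≤ z →
  Σ (Fin m → Fin (m + k)) λ ρ → Increasing ρ × (∀ i → f (ρ i) ≤ z / k)
select-sparse {k} m z f Σf≤z = ρ , inc , λ i → ≮⇒≥ (not-marked i)
  where
  d = z / k
  dense = λ i → ⌊ d <? f i ⌋
  few-dense : countFin dense < k
  few-dense = *-cancelʳ-< (suc d) _ _ (begin-strict
    countFin dense * suc d   ≤⟨ markov d f ⟩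
    sumFin f                 ≤⟨ Σf≤z ⟩
    z                        ≡⟨ m≡m%n+[m/n]*n z k ⟩
    z % k + d * k            <⟨ +-monoˡ-< (d * k) (m%n<n z k) ⟩
    k + d * k                ≡⟨ *-comm (suc d) k ⟩
    k * suc d                ∎)
    where open ≤-Reasoning
  selection = select-unmarked m (m + k) dense (+-monoʳ-≤ m (<⇒≤ few-dense))
  ρ = proj₁ selection
  inc = proj₁ (proj₂ selection)
  not-marked : ∀ i → ¬ d < f (ρ i)
  not-marked i d<f = contradiction (trans (sym (holds⁺ (d <? f (ρ i)) d<f)) (proj₂ (proj₂ selection) i)) λ ()

sumFin-swap-≤ : ∀ {m n} (f : Fin m → Fin n → ℕ) → sumFin (λ j → sumFin (λ i → f i j)) ≤ sumFin (λ i → sumFin (f i))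
sumFin-swap-≤ {m} {n} f = begin
  sumFin (λ j → sumFin (λ i → f i j))                    ≡⟨ ∑-allFin (λ j → sumFin (λ i → f i j)) ⟨
  ∑ (allFin n) (λ j → sumFin (λ i → f i j))              ≤⟨ ∑-mono (allFin n) (λ j → ≤-reflexive (sym (∑-allFin (λ i → f i j)))) ⟩
  ∑ (allFin n) (λ j → ∑ (allFin m) (λ i → f i j))        ≡⟨ ∑-swap (allFin m) (allFin n) f ⟨
  ∑ (allFin m) (λ i → ∑ (allFin n) (f i))                ≤⟨ ∑-mono (allFin m) (λ i → ≤-reflexive (∑-allFin (f i))) ⟩
  ∑ (allFin m) (λ i → sumFin (f i))                      ≡⟨ ∑-allFin (λ i → sumFin (f i)) ⟩
  sumFin (λ i → sumFin (f i))                            ∎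
  where open ≤-Reasoning

toℕ-mod : ∀ {n} ⦃ _ : NonZero n ⦄ {x} → x < n → toℕ (x mod n) ≡ x
toℕ-mod x<n = trans (toℕ-fromℕ< _) (m<n⇒m%n≡m x<n)

count-restricted-≤ : ∀ {m n} ⦃ _ : NonZero n ⦄ {γ : Fin n → Fin m} → Increasing γ → (F : Fin m → Bool) →
  ∑ (upTo n) (λ y → 𝟙 (F (γ (y mod n)))) ≤ countFin F
count-restricted-≤ {m} {n} {γ} inc F = ≤-trans
  (count-injection Fin._≟_ (upTo⁺ n) _ F (λ y → γ (y mod n))
    (λ _ → ∈-allFin _) id
    (λ {y} {y′} y∈ y′∈ _ _ eq → trans (sym (toℕ-mod (∈-upTo⁻ y∈)))
      (trans (cong toℕ (increasing-injective inc {y mod n} {y′ mod n} eq)) (toℕ-mod (∈-upTo⁻ y′∈)))))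
  (≤-reflexive (∑-allFin (𝟙 ∘ F)))

-- Permutation matrices

unique-one : ∀ {n} (f : Fin n → Bool) → countFin f ≡ 1 → ∃ λ j → f j ≡ true × (∀ j′ → f j′ ≡ true → j′ ≡ j)
unique-one {suc n} f count≡1 with f fzero in eq
... | true  = fzero , eq , only
  where
  only : ∀ j′ → f j′ ≡ true → j′ ≡ fzero
  only fzero     _  = refl
  only (fsuc j′) fj = contradiction
    (≤-trans (≤-reflexive (cong 𝟙 (sym fj))) (≤-trans (term-≤-sumFin (𝟙 ∘ f ∘ fsuc) j′) (≤-reflexive (suc-injective count≡1)))) λ ()
... | false = let j , fj , only = unique-one (f ∘ fsuc) count≡1
  in fsuc j , fj , λ { fzero f0 → contradiction (trans (sym f0) eq) λ ()
                     ; (fsuc j′) fj′ → cong fsuc (only j′ fj′) }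

-- A pair of distinct rows with distance vector `v` contributes to `repetitions` the term with
-- columns `π i` and `π i′`.
few-repetitions : ∀ {k c} (P : BinMatrix k k) (π : Fin k → Fin k) → (∀ i → P i (π i) ≡ true) →
  RepetitionFree (suc c) P → FewRepetitions π c
few-repetitions {k} P π Pπ free v@(v₁ , v₂) = ≤-trans pairs≤repetitions (≤-pred (≰⇒> (free v)))
  where
  h : Fin k → Fin k → Bool
  h i i′ = not ⌊ i Fin.≟ i′ ⌋ ∧ ⌊ Product.≡-dec ℤ._≟_ ℤ._≟_ (distVec i (π i) i′ (π i′)) v ⌋
  t : Fin k → Fin k → Fin k → Fin k → Bool
  t i₁ j₁ i₂ j₂ = P i₁ j₁ ∧ P i₂ j₂ ∧ not (⌊ i₁ Fin.≟ i₂ ⌋ ∧ ⌊ j₁ Fin.≟ j₂ ⌋)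
    ∧ (⌊ proj₁ (distVec i₁ j₁ i₂ j₂) ℤ.≟ v₁ ⌋ ∧ ⌊ proj₂ (distVec i₁ j₁ i₂ j₂) ℤ.≟ v₂ ⌋)
  h⇒t : ∀ i i′ → h i i′ ≡ true → t i (π i) i′ (π i′) ≡ true
  h⇒t i i′ p = ∧⁺ (Pπ i) (∧⁺ (Pπ i′) (∧⁺ distinct (∧⁺ (holds⁺ (_ ℤ.≟ v₁) (cong proj₁ vec≡v)) (holds⁺ (_ ℤ.≟ v₂) (cong proj₂ vec≡v)))))
    where
    vec≡v = holds (Product.≡-dec ℤ._≟_ ℤ._≟_ (distVec i (π i) i′ (π i′)) v) (∧-conicalʳ (not ⌊ i Fin.≟ i′ ⌋) _ p)
    distinct : not (⌊ i Fin.≟ i′ ⌋ ∧ ⌊ π i Fin.≟ π i′ ⌋) ≡ true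
    distinct with ⌊ i Fin.≟ i′ ⌋ | ∧-conicalˡ (not ⌊ i Fin.≟ i′ ⌋) _ p
    ... | false | _ = refl
  pairs≤repetitions : ∑ (cartesianProduct (allFin k) (allFin k)) (λ (i , i′) → 𝟙 (h i i′)) ≤ repetitions P v
  pairs≤repetitions = begin
    ∑ (cartesianProduct (allFin k) (allFin k)) (λ (i , i′) → 𝟙 (h i i′))
      ≡⟨ ∑-cartesianProduct (allFin k) (allFin k) _ ⟩
    ∑ (allFin k) (λ i → ∑ (allFin k) (λ i′ → 𝟙 (h i i′)))
      ≡⟨ ∑-allFin (λ i → ∑ (allFin k) (λ i′ → 𝟙 (h i i′))) ⟩
    sumFin (λ i → ∑ (allFin k) (λ i′ → 𝟙 (h i i′)))
      ≤⟨ sumFin-mono (λ i → ≤-trans (≤-reflexive (∑-allFin (λ i′ → 𝟙 (h i i′)))) (≤-trans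
           (sumFin-mono (λ i′ → ≤-trans (𝟙-mono (h⇒t i i′)) (term-≤-sumFin (𝟙 ∘ t i (π i) i′) (π i′))))
           (term-≤-sumFin (λ j → sumFin (λ i′ → countFin (t i j i′))) (π i)))) ⟩
    repetitions P v
      ∎
    where open ≤-Reasoning

-- The bound z ≤ (k/3)(k/r)^{1/3} on the number z of zeros, cubed and cleared of denominators, reads
-- 27rz³ ≤ k⁴.
theorem4p3 : (k r : ℕ) → 9 ≤ k → 3 ≤ r →
    (A : BinMatrix (4 * k) (4 * k)) (P : BinMatrix k k) →
    IsPermutationMatrix P → RepetitionFree r P →
    27 * r * (zeroEntries A ^ 3) ≤ k ^ 4 →
    Contains A P
theorem4p3 k@(suc _) (suc c) _ _ A P (one-per-row , _) free few-zeros =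
  contains (zero-free-copy d c Z π 27cd³≤k (few-repetitions P π (proj₁ ∘ proj₂ ∘ one) free)
    (λ x → ≤-trans (count-restricted-≤ γ-inc (λ j → not (A (ρ (x mod N)) j))) (ρ-sparse (x mod N)))
    (λ y → ≤-trans (count-restricted-≤ ρ-inc (λ i → not (A i (γ (y mod N))))) (γ-sparse (y mod N))))
  where
  N = 3 * k
  z = zeroEntries A
  d = z / k

  one : ∀ i → ∃ λ j → P i j ≡ true × (∀ j′ → P i j′ ≡ true → j′ ≡ j)
  one i = unique-one (P i) (one-per-row i)

  π : Fin k → Fin k
  π i = proj₁ (one i)

  4k≡3k+k : 4 * k ≡ N + k
  4k≡3k+k = +-comm k N

  sparse-lines : (f : Fin (4 * k) → ℕ) → sumFin f ≤ z →
    Σ (Fin N → Fin (4 * k)) λ ρ → Increasing ρ × (∀ i → f (ρ i) ≤ d)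
  sparse-lines = subst
    (λ n → (f : Fin n → ℕ) → sumFin f ≤ z → Σ (Fin N → Fin n) λ ρ → Increasing ρ × (∀ i → f (ρ i) ≤ d))
    (sym 4k≡3k+k) (select-sparse N z)

  -- Zeros are counted along full lines of `A`, so rows and columns are chosen independently;
  -- deleting the others only lowers the counts.
  rows = sparse-lines (λ i → countFin (λ j → not (A i j))) ≤-refl
  columns = sparse-lines (λ j → countFin (λ i → not (A i j))) (sumFin-swap-≤ (λ i j → 𝟙 (not (A i j))))
  ρ = proj₁ rows
  ρ-inc = proj₁ (proj₂ rows)
  ρ-sparse = proj₂ (proj₂ rows)
  γ = proj₁ columns
  γ-inc = proj₁ (proj₂ columns)
  γ-sparse = proj₂ (proj₂ columns)

  -- The value `true` marks a zero of the submatrix. Reducing indices mod `N` makes every line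
  -- sparse, even one with index beyond `N`.
  Z : ℕ → ℕ → Bool
  Z x y = not (A (ρ (x mod N)) (γ (y mod N)))

  27cd³≤k : 27 * suc c * (d * d * d) ≤ k
  -- Since dk ≤ z, the hypothesis bounds 27r(dk)³ by k⁴, and k³ cancels.
  27cd³≤k = *-cancelʳ-≤ _ _ (k ^ 3) ⦃ m^n≢0 k 3 ⦄ (begin
    27 * suc c * (d * d * d) * k ^ 3     ≡⟨ cube-* (27 * suc c) d k ⟩
    27 * suc c * (d * k) ^ 3             ≤⟨ *-monoʳ-≤ (27 * suc c) (^-monoˡ-≤ 3 (m/n*n≤m z k)) ⟩
    27 * suc c * z ^ 3                   ≤⟨ few-zeros ⟩
    k ^ 4                                ∎)
    where
    open ≤-Reasoning
    cube-* : ∀ m d k → m * (d * d * d) * (k * (k * (k * 1))) ≡ m * (d * k * (d * k * (d * k * 1)))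
    cube-* = solve-∀

  contains : ZeroFreeCopy N Z π → Contains A P
  contains (p , b , p<N , p-mono , b+k≤N , avoids) =
    (λ i → ρ (p i mod N)) , (λ j → γ ((b + toℕ j) mod N)) ,
    (λ i i′ i<i′ → ρ-inc _ _ (subst₂ _<_ (sym (toℕ-mod (p<N i))) (sym (toℕ-mod (p<N i′))) (p-mono i i′ i<i′))) ,
    (λ j j′ j<j′ → γ-inc _ _ (subst₂ _<_ (sym (toℕ-mod (b+j<N j))) (sym (toℕ-mod (b+j<N j′))) (+-monoʳ-< b j<j′))) ,
    λ i j Pij → one-entry i j (proj₂ (proj₂ (one i)) j Pij)
    where
    b+j<N : ∀ (j : Fin k) → b + toℕ j < N
    b+j<N j = <-≤-trans (+-monoʳ-< b (toℕ<n j)) b+k≤N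
    not-false : ∀ {a} → not a ≡ false → a ≡ true
    not-false {true} _ = refl
    one-entry : ∀ i j → j ≡ π i → A (ρ (p i mod N)) (γ ((b + toℕ j) mod N)) ≡ true
    one-entry i _ refl = not-false (avoids i)
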